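{- Let $X_n,Y_n,M_n,P_n$ $(n\ge0)$ be the recursively defined sequences given in the context. The sequences of first differences, indexed by $n\ge 0$, satisfy $$\{\Delta X\}=\varTheta(2,1,1),\qquad \{\Delta Y\}=\varTheta(3,3,2),\qquad \{\Delta M\}=\varTheta(1,2,1),\qquad \{\Delta P\}=\varTheta(5,4,3).$$
   Context: $\operatorname{mex}(S)$ is the smallest nonnegative integer not in $S$. Set $X_0=Y_0=M_0=P_0=0$ and, for $n>0$, $X_n=\operatorname{mex}\{X_i,Y_i:i<n\}$, $M_n=\operatorname{mex}\{M_i,P_i:i<n\}$, $Y_n=X_n+M_n$, $P_n=X_n+Y_n$. For a sequence $\{s_n\}_{n\ge0}$, $\Delta s_n=s_{n+1}-s_n$, and $\{\Delta s\}$ denotes the sequence $(\Delta s_n)_{n\ge0}$. $\varTheta(a,b,c)$ is the infinite word, indexed by $n\ge0$, that is the fixed point of the morphism $\theta: a\to cabaaba,\ b\to cababa,\ c\to caba$ (it begins with $c$ and equals $\lim_{k\to\infty}\theta^k(c)$). For integers $u,v,w$ (not necessarily distinct), $\varTheta(u,v,w)$ is the integer sequence obtained from $\varTheta(a,b,c)$ by replacing every $a$ by $u$, every $b$ by $v$ and every $c$ by $w$. -}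

module Defs where

open import Data.Fin.Base using (zero; suc; toℕ; fromℕ<)
open import Data.Fin.Properties using (toℕ-fromℕ<)
open import Data.Integer.Base using (ℤ; +_; _-_)
open import Data.List.Base
  using (List; []; _∷_; [_]; _++_; length; lookup; concatMap; applyUpTo)
open import Data.List.Extrema.Nat using (max; xs≤max)
open import Data.List.Membership.Propositional using (_∈_; _∉_)
open import Data.List.Properties
  using (length-++; concatMap-++; ++-assoc; ++-identityʳ)
import Data.List.Relation.Unary.All as All
open import Data.Nat.Base
open import Data.Nat.Properties
open import Data.Product.Base using (∃; _×_; _,_; proj₁; proj₂)
open import Data.Sum.Base using (inj₁; inj₂)
open import Relation.Binary.PropositionalEquality
  using (_≡_; refl; sym; trans; cong; cong₂; subst)
open import Relation.Nullary using (yes; no)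

open import Data.List.Membership.DecPropositional _≟_ using (_∈?_)

IsMex : List ℕ → ℕ → Set
IsMex S m = m ∉ S × (∀ k → k ∉ S → m ≤ k)

private
  -- Linear search from k upwards; it stops because f + k is not in S.
  search : ∀ S f k → f + k ∉ S → (∀ j → j ∉ S → k ≤ j) → ∃ (IsMex S)
  search S zero    k f+k∉S k≤ = k , f+k∉S , k≤
  search S (suc f) k f+k∉S k≤ with k ∈? S
  ... | no  k∉S = k , k∉S , k≤
  ... | yes k∈S = search S f (suc k)
    (subst (_∉ S) (sym (+-suc f k)) f+k∉S)
    (λ j j∉S → ≤∧≢⇒< (k≤ j j∉S) λ k≡j → j∉S (subst (_∈ S) k≡j k∈S))

  1+max∉ : ∀ S → suc (max 0 S) + 0 ∉ S
  1+max∉ S 1+max∈S = 1+n≰n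
    (subst (_≤ max 0 S) (+-identityʳ _) (All.lookup (xs≤max 0 S) 1+max∈S))

  ∃mex : ∀ S → ∃ (IsMex S)
  ∃mex S = search S (suc (max 0 S)) 0 (1+max∉ S) (λ _ _ → z≤n)

mex : List ℕ → ℕ
mex S = proj₁ (∃mex S)

mex-isMex : ∀ S → IsMex S (mex S)
mex-isMex S = proj₂ (∃mex S)

-- XYs n lists { Xᵢ , Yᵢ : i < n } and MPs n lists { Mᵢ , Pᵢ : i < n }.
mutual
  X Y M P : ℕ → ℕ

  X zero      = 0
  X n@(suc _) = mex (XYs n)

  M zero      = 0
  M n@(suc _) = mex (MPs n)

  Y zero      = 0
  Y n@(suc _) = X n + M n

  P zero      = 0
  P n@(suc _) = X n + Y n

  XYs MPs : ℕ → List ℕ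

  XYs zero    = []
  XYs (suc n) = X n ∷ Y n ∷ XYs n

  MPs zero    = []
  MPs (suc n) = M n ∷ P n ∷ MPs n

Δ : (ℕ → ℕ) → ℕ → ℤ
Δ s n = + s (suc n) - + s n

data Letter : Set where
  a b c : Letter

θ : Letter → List Letter
θ a = c ∷ a ∷ b ∷ a ∷ a ∷ b ∷ a ∷ []
θ b = c ∷ a ∷ b ∷ a ∷ b ∷ a ∷ []
θ c = c ∷ a ∷ b ∷ a ∷ []

θ* : List Letter → List Letter
θ* = concatMap θ

θ^_⟨c⟩ : ℕ → List Letter
θ^ zero  ⟨c⟩ = [ c ]
θ^ suc k ⟨c⟩ = θ* θ^ k ⟨c⟩

private
  θ*-length : ∀ u → length u + length u ≤ length (θ* u)
  θ*-length []      = z≤n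
  θ*-length (x ∷ u) = begin
    suc (length u + suc (length u))  ≡⟨ cong suc (+-suc _ _) ⟩
    2 + (length u + length u)        ≤⟨ +-mono-≤ (2≤ x) (θ*-length u) ⟩
    length (θ x) + length (θ* u)     ≡⟨ length-++ (θ x) ⟨
    length (θ* (x ∷ u))              ∎
    where
    open ≤-Reasoning
    2≤ : ∀ x → 2 ≤ length (θ x)
    2≤ a = s≤s (s≤s z≤n)
    2≤ b = s≤s (s≤s z≤n)
    2≤ c = s≤s (s≤s z≤n)

n<∣θⁿ∣ : ∀ n → n < length θ^ n ⟨c⟩
n<∣θⁿ∣ zero    = s≤s z≤n
n<∣θⁿ∣ (suc n) = ≤-trans
  (+-mono-≤ (≤-trans (s≤s z≤n) (n<∣θⁿ∣ n)) (n<∣θⁿ∣ n)) (θ*-length θ^ n ⟨c⟩)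

-- The words θᵏ(c) are prefixes of one another, so the n-th letter of their
-- limit is the n-th letter of any of them that is long enough; θⁿ(c) is.
Θ : ℕ → Letter
Θ n = lookup θ^ n ⟨c⟩ (fromℕ< (n<∣θⁿ∣ n))

replaceBy : ℤ → ℤ → ℤ → Letter → ℤ
replaceBy u v w a = u
replaceBy u v w b = v
replaceBy u v w c = w

Θ⟨_,_,_⟩ : ℤ → ℤ → ℤ → ℕ → ℤ
Θ⟨ u , v , w ⟩ n = replaceBy u v w (Θ n)

_IsPrefixOf_ : List Letter → (ℕ → Letter) → Set
u IsPrefixOf w = ∀ i → lookup u i ≡ w (toℕ i)

private
  lookup-prefix : ∀ (u {v} : List Letter) {z} → u ++ z ≡ v →
                  ∀ i j → toℕ i ≡ toℕ j → lookup u i ≡ lookup v j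
  lookup-prefix (x ∷ u) refl zero    zero    _  = refl
  lookup-prefix (x ∷ u) refl (suc i) (suc j) eq =
    lookup-prefix u refl i j (suc-injective eq)

  θ^-step : ∀ k → ∃ λ z → θ^ k ⟨c⟩ ++ z ≡ θ^ suc k ⟨c⟩
  θ^-step zero    = _ , refl
  θ^-step (suc k) with z , eq ← θ^-step k =
    θ* z , trans (sym (concatMap-++ θ θ^ k ⟨c⟩ z)) (cong θ* eq)

  θ^-mono : ∀ {k l} → k ≤′ l → ∃ λ z → θ^ k ⟨c⟩ ++ z ≡ θ^ l ⟨c⟩
  θ^-mono ≤′-refl = [] , ++-identityʳ _
  θ^-mono {k} {suc l} (≤′-step k≤l) with z , eq ← θ^-mono k≤l | z′ , eq′ ← θ^-step l =
    z ++ z′ ,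
    trans (sym (++-assoc θ^ k ⟨c⟩ z z′)) (trans (cong (_++ z′) eq) eq′)

  prefix-shrink : ∀ w u {v z} → u ++ z ≡ v → v IsPrefixOf w → u IsPrefixOf w
  prefix-shrink w (x ∷ u) refl p zero    = p zero
  prefix-shrink w (x ∷ u) refl p (suc i) =
    prefix-shrink (λ n → w (suc n)) u refl (λ j → p (suc j)) i

  prefix-applyUpTo : ∀ w n u → n ≤ length u → u IsPrefixOf w →
                     ∃ λ z → applyUpTo w n ++ z ≡ u
  prefix-applyUpTo w zero    u       _        _ = u , refl
  prefix-applyUpTo w (suc n) (x ∷ u) (s≤s n≤) p
    with z , eq ← prefix-applyUpTo (λ n → w (suc n)) n u n≤ (λ j → p (suc j)) =
    z , cong₂ _∷_ (sym (p zero)) eq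

Θ-isLimit : ∀ k → θ^ k ⟨c⟩ IsPrefixOf Θ
Θ-isLimit k i with ≤-total k (toℕ i)
... | inj₁ k≤i = lookup-prefix θ^ k ⟨c⟩ (proj₂ (θ^-mono (≤⇒≤′ k≤i)))
                   i _ (sym (toℕ-fromℕ< _))
... | inj₂ i≤k = sym (lookup-prefix θ^ toℕ i ⟨c⟩ (proj₂ (θ^-mono (≤⇒≤′ i≤k)))
                   _ i (toℕ-fromℕ< _))

Θ-isFixedPoint : ∀ n → θ* (applyUpTo Θ n) IsPrefixOf Θ
Θ-isFixedPoint n
  with z , eq ← prefix-applyUpTo Θ n θ^ n ⟨c⟩ (<⇒≤ (n<∣θⁿ∣ n)) (Θ-isLimit n) =
  prefix-shrink Θ (θ* (applyUpTo Θ n))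
    (trans (sym (concatMap-++ θ (applyUpTo Θ n) z)) (cong θ* eq))
    (Θ-isLimit (suc n))

{-# OPTIONS --safe #-}
module Submission where

-- Let τ be the morphism a → ba, b → ca, c → a, the Tribonacci morphism with its
-- images reversed.  The proof rests on the identity
--
--     Θ = c τ(Θ)                                              (Θ-desubstitute)
--
-- which follows from τ(θ(u)) aba = aba θ(τ(u)) by induction on the powers of θ.
--
-- Let x, y, m, p be the partial sums of the four claimed difference words.
-- Adding the values letter by letter gives y = x + m and p = x + y.  What has
-- to be shown is that the positive integers are the disjoint union of the xᵢ
-- and the yᵢ (i > 0), and also of the mᵢ and the pᵢ.  A word over the marks
-- true and false records such a splitting.  Writing X for true and Y for
-- false, the positions of the X's in the word φ(Θ), where
--     φ : a → YX,  b → X,  c → X,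
-- are exactly the xᵢ (i > 0), and the positions of the Y's in ψ(Θ), where
--     ψ : a → XXY,  b → XXY,  c → XY,
-- are exactly the yᵢ (i > 0).  Now X φ(τ(u)) = ψ(u) X for every word u, hence
-- φ(Θ) = φ(c τ(Θ)) = X φ(τ(Θ)) = ψ(Θ), so the xᵢ and the yᵢ are complementary.
-- For m and p, with marks M for true and P for false, the same argument uses
-- Θ = c τ(c τ(Θ)): with
--     μ : a → M,  b → PM,  c → M     and     π : a → MMMMP,  b → MMMP,  c → MMP
-- one has MM μ(τ(τ(u))) = π(u) MM, hence μ(Θ) = π(Θ).
--
-- Finally, if f 0 = g 0 = 0, f increases strictly, f ≤ g, and the values of f
-- and g at positive indices partition the positive integers, then f n is the mex
-- of the values of f and g at smaller indices.  So x, y, m, p satisfy the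
-- recursion that determines X, Y, M, P.

open import Defs
open import Data.Bool.Base using (Bool; true; false; not)
import Data.Integer.Base as ℤ
open import Data.Integer.Base using (+_)
open import Data.Integer.Properties using (m-n≡m⊖n; ⊖-≥)
open import Data.List.Base
  using (List; []; _∷_; [_]; _++_; _∷ʳ_; length; replicate; concatMap; applyUpTo)
open import Data.List.Membership.Propositional using (_∈_; _∉_)
open import Data.List.Properties
  using (length-++; concatMap-++; ++-assoc; ++-identityʳ;
         applyUpTo-∷ʳ; length-applyUpTo; ∷-injectiveˡ; ∷-injectiveʳ)
open import Data.List.Relation.Unary.Any using (here; there)
open import Data.Fin.Base using (zero; suc)
open import Data.Nat.Base
open import Data.Nat.Properties
open import Algebra.Properties.CommutativeSemigroup +-commutativeSemigroup
  using (interchange)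
open import Data.Product.Base using (∃; ∃₂; _×_; _,_; proj₁; proj₂)
open import Data.Sum.Base using (_⊎_; inj₁; inj₂)
open import Function.Base using (_∘_)
open import Relation.Binary.PropositionalEquality
  using (_≡_; _≢_; _≗_; refl; sym; trans; cong; cong₂; subst; module ≡-Reasoning)

-- Morphisms of words

private variable
  A B : Set

concatMap-concatMap : (f : B → List A) (g : Letter → List B) → ∀ u →
                      concatMap f (concatMap g u) ≡ concatMap (concatMap f ∘ g) u
concatMap-concatMap f g []      = refl
concatMap-concatMap f g (l ∷ u) =
  trans (concatMap-++ f (g l) (concatMap g u))
        (cong (concatMap f (g l) ++_) (concatMap-concatMap f g u))

-- Morphisms that are conjugate through s on letters are so on all words.
conjugate : (f g : Letter → List A) (s : List A) →
            (∀ l → f l ++ s ≡ s ++ g l) →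
            ∀ u → concatMap f u ++ s ≡ s ++ concatMap g u
conjugate f g s fs≡sg []      = sym (++-identityʳ s)
conjugate f g s fs≡sg (l ∷ u) = begin
  (f l ++ concatMap f u) ++ s  ≡⟨ ++-assoc (f l) _ s ⟩
  f l ++ (concatMap f u ++ s)  ≡⟨ cong (f l ++_) (conjugate f g s fs≡sg u) ⟩
  f l ++ (s ++ concatMap g u)  ≡⟨ ++-assoc (f l) s _ ⟨
  (f l ++ s) ++ concatMap g u  ≡⟨ cong (_++ concatMap g u) (fs≡sg l) ⟩
  (s ++ g l) ++ concatMap g u  ≡⟨ ++-assoc s (g l) _ ⟩
  s ++ (g l ++ concatMap g u)  ∎
  where open ≡-Reasoning

length-concatMap-≥ : (f : Letter → List A) → (∀ l → 1 ≤ length (f l)) →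
                     ∀ u → length u ≤ length (concatMap f u)
length-concatMap-≥ f 1≤f []      = z≤n
length-concatMap-≥ f 1≤f (l ∷ u) =
  ≤-trans (+-mono-≤ (1≤f l) (length-concatMap-≥ f 1≤f u))
          (≤-reflexive (sym (length-++ (f l))))

-- Prefixes of infinite words

applyUpTo-+ : (w : ℕ → A) → ∀ m n →
              applyUpTo w (m + n) ≡ applyUpTo w m ++ applyUpTo (λ i → w (m + i)) n
applyUpTo-+ w zero    n = refl
applyUpTo-+ w (suc m) n = cong (w 0 ∷_) (applyUpTo-+ (w ∘ suc) m n)

prefix⇒applyUpTo : ∀ {w} u → u IsPrefixOf w → u ≡ applyUpTo w (length u)
prefix⇒applyUpTo []      p = refl
prefix⇒applyUpTo (l ∷ u) p = cong₂ _∷_ (p zero) (prefix⇒applyUpTo u (p ∘ suc))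

++⇒applyUpTo : ∀ (w : ℕ → A) u {z} n → u ++ z ≡ applyUpTo w n →
               u ≡ applyUpTo w (length u)
++⇒applyUpTo w []      n       eq = refl
++⇒applyUpTo w (x ∷ u) (suc n) eq =
  cong₂ _∷_ (∷-injectiveˡ eq) (++⇒applyUpTo (w ∘ suc) u n (∷-injectiveʳ eq))

-- The prefix of Θ of length n.
Θ↾ : ℕ → List Letter
Θ↾ = applyUpTo Θ

Θ↾-suc : ∀ n → Θ↾ (suc n) ≡ Θ↾ n ++ [ Θ n ]
Θ↾-suc n = sym (applyUpTo-∷ʳ Θ n)

θ^≡Θ↾ : ∀ k → θ^ k ⟨c⟩ ≡ Θ↾ (length θ^ k ⟨c⟩)
θ^≡Θ↾ k = prefix⇒applyUpTo θ^ k ⟨c⟩ (Θ-isLimit k)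

Θ↾-prefix-θ^ : ∀ n → ∃ λ z → Θ↾ n ++ z ≡ θ^ n ⟨c⟩
Θ↾-prefix-θ^ n with k , eq ← m≤n⇒∃[o]m+o≡n (<⇒≤ (n<∣θⁿ∣ n)) =
  _ , trans (sym (applyUpTo-+ Θ n k)) (trans (cong Θ↾ eq) (sym (θ^≡Θ↾ n)))

-- The Tribonacci structure of Θ

-- A conjugate of the cube of τ is θ.
τ : Letter → List Letter
τ a = b ∷ a ∷ []
τ b = c ∷ a ∷ []
τ c = a ∷ []

τ* : List Letter → List Letter
τ* = concatMap τ

τθ-conjugate-θτ : ∀ u → τ* (θ* u) ++ a ∷ b ∷ a ∷ [] ≡ a ∷ b ∷ a ∷ θ* (τ* u)
τθ-conjugate-θτ u = begin
  τ* (θ* u) ++ aba              ≡⟨ cong (_++ aba) (concatMap-concatMap τ θ u) ⟩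
  concatMap (τ* ∘ θ) u ++ aba   ≡⟨ conjugate (τ* ∘ θ) (θ* ∘ τ) aba letterwise u ⟩
  aba ++ concatMap (θ* ∘ τ) u   ≡⟨ cong (aba ++_) (concatMap-concatMap θ τ u) ⟨
  aba ++ θ* (τ* u)              ∎
  where
  open ≡-Reasoning
  aba = a ∷ b ∷ a ∷ []
  letterwise : ∀ l → τ* (θ l) ++ aba ≡ aba ++ θ* (τ l)
  letterwise a = refl
  letterwise b = refl
  letterwise c = refl

-- With τθ-conjugate-θτ, applying θ to the statement for k gives that for k + 1.
cτ-prefix : ∀ k → ∃ λ z → c ∷ τ* θ^ k ⟨c⟩ ++ z ≡ θ^ suc k ⟨c⟩
cτ-prefix zero    = b ∷ a ∷ [] , refl
cτ-prefix (suc k) with z , eq ← cτ-prefix k = aba ++ θ* z , (begin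
  c ∷ τ* (θ* u) ++ (aba ++ θ* z)  ≡⟨ cong (c ∷_) (++-assoc (τ* (θ* u)) aba _) ⟨
  c ∷ (τ* (θ* u) ++ aba) ++ θ* z  ≡⟨ cong (λ v → c ∷ v ++ θ* z) (τθ-conjugate-θτ u) ⟩
  θ* (c ∷ τ* u) ++ θ* z           ≡⟨ concatMap-++ θ (c ∷ τ* u) z ⟨
  θ* (c ∷ τ* u ++ z)              ≡⟨ cong θ* eq ⟩
  θ* (θ^ suc k ⟨c⟩)               ∎)
  where
  open ≡-Reasoning
  u   = θ^ k ⟨c⟩
  aba = a ∷ b ∷ a ∷ []

-- The finite form of Θ = c τ(Θ).
Θ-desubstitute : ∀ n → ∃ λ n′ → n ≤ n′ × Θ↾ n′ ≡ c ∷ τ* (Θ↾ n)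
Θ-desubstitute n = length cτΘ↾ , n≤ , sym (++⇒applyUpTo Θ cτΘ↾ _ extends)
  where
  open ≡-Reasoning
  cτΘ↾ = c ∷ τ* (Θ↾ n)
  z    = proj₁ (Θ↾-prefix-θ^ n)
  z′   = proj₁ (cτ-prefix n)

  1≤∣τ∣ : ∀ l → 1 ≤ length (τ l)
  1≤∣τ∣ a = s≤s z≤n
  1≤∣τ∣ b = s≤s z≤n
  1≤∣τ∣ c = s≤s z≤n

  n≤ : n ≤ length cτΘ↾
  n≤ = m≤n⇒m≤1+n (subst (_≤ length (τ* (Θ↾ n))) (length-applyUpTo Θ n)
                        (length-concatMap-≥ τ 1≤∣τ∣ (Θ↾ n)))

  extends : cτΘ↾ ++ (τ* z ++ z′) ≡ Θ↾ (length θ^ suc n ⟨c⟩)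
  extends = begin
    c ∷ τ* (Θ↾ n) ++ (τ* z ++ z′)  ≡⟨ cong (c ∷_) (++-assoc (τ* (Θ↾ n)) (τ* z) z′) ⟨
    c ∷ (τ* (Θ↾ n) ++ τ* z) ++ z′  ≡⟨ cong (λ v → c ∷ v ++ z′) (concatMap-++ τ (Θ↾ n) z) ⟨
    c ∷ τ* (Θ↾ n ++ z) ++ z′       ≡⟨ cong (λ v → c ∷ τ* v ++ z′) (proj₂ (Θ↾-prefix-θ^ n)) ⟩
    c ∷ τ* θ^ n ⟨c⟩ ++ z′          ≡⟨ proj₂ (cτ-prefix n) ⟩
    θ^ suc n ⟨c⟩                   ≡⟨ θ^≡Θ↾ (suc n) ⟩
    Θ↾ (length θ^ suc n ⟨c⟩)       ∎

-- Words of marks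

-- At z k t: the k-th entry of z is t, where entries are counted from 1.
data At : List Bool → ℕ → Bool → Set where
  here  : ∀ {t z} → At (t ∷ z) 1 t
  there : ∀ {t s z k} → At z k t → At (s ∷ z) (suc k) t

At-functional : ∀ {z k s t} → At z k s → At z k t → s ≡ t
At-functional here      here      = refl
At-functional (there p) (there q) = At-functional p q
At-functional (there ()) here
At-functional here      (there ())

At-total : ∀ z {k} → 0 < k → k ≤ length z → ∃ (At z k)
At-total (t ∷ z) {suc zero}    _ _         = t , here
At-total (t ∷ z) {suc (suc k)} _ (s≤s k≤)
  with s , p ← At-total z (s≤s z≤n) k≤ = s , there p

At-++ˡ : ∀ {z k t} r → At z k t → At (z ++ r) k t
At-++ˡ r here      = here
At-++ˡ r (there p) = there (At-++ˡ r p)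

At-++ʳ : ∀ z {r k t} → At r k t → At (z ++ r) (length z + k) t
At-++ʳ []      p = p
At-++ʳ (_ ∷ z) p = there (At-++ʳ z p)

At-++⁻ : ∀ z {r k t} → At (z ++ r) k t →
         At z k t ⊎ ∃ λ j → At r j t × k ≡ length z + j
At-++⁻ []      p         = inj₂ (_ , p , refl)
At-++⁻ (_ ∷ z) here      = inj₁ here
At-++⁻ (_ ∷ z) (there p) with At-++⁻ z p
... | inj₁ q            = inj₁ (there q)
... | inj₂ (j , q , eq) = inj₂ (j , q , cong suc eq)

At-replicate⁻ : ∀ n {k s t} → At (replicate n s) k t → s ≡ t
At-replicate⁻ (suc n) here      = refl
At-replicate⁻ (suc n) (there p) = At-replicate⁻ n p

-- The word of length n + 1 whose last entry, and no other, is t.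
block : Bool → ℕ → List Bool
block t n = replicate n (not t) ∷ʳ t

length-block : ∀ t n → length (block t n) ≡ suc n
length-block t zero    = refl
length-block t (suc n) = cong suc (length-block t n)

At-block : ∀ t n → At (block t n) (suc n) t
At-block t zero    = here
At-block t (suc n) = there (At-block t n)

At-block⁻ : ∀ t n {k} → At (block t n) k t → k ≡ suc n
At-block⁻ t     zero    here      = refl
At-block⁻ true  (suc n) (there p) = cong suc (At-block⁻ true n p)
At-block⁻ false (suc n) (there p) = cong suc (At-block⁻ false n p)

-- Sequences whose differences are coded by Θ

-- The sequence from 0 whose n-th difference is e (Θ n) + 1; thus e counts the
-- integers that are passed over.
position : (Letter → ℕ) → ℕ → ℕ
position e zero    = 0
position e (suc n) = position e n + suc (e (Θ n))

-- The word in which the entries equal to t are to mark the values of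
-- position e.
code : Bool → (Letter → ℕ) → List Letter → List Bool
code t e = concatMap (block t ∘ e)

code-suc : ∀ t e n → code t e (Θ↾ (suc n)) ≡ code t e (Θ↾ n) ++ block t (e (Θ n))
code-suc t e n = begin
  code t e (Θ↾ (suc n))                         ≡⟨ cong (code t e) (Θ↾-suc n) ⟩
  code t e (Θ↾ n ++ [ Θ n ])                    ≡⟨ concatMap-++ (block t ∘ e) (Θ↾ n) _ ⟩
  code t e (Θ↾ n) ++ (block t (e (Θ n)) ++ [])  ≡⟨ cong (code t e (Θ↾ n) ++_) (++-identityʳ _) ⟩
  code t e (Θ↾ n) ++ block t (e (Θ n))          ∎
  where open ≡-Reasoning

length-code : ∀ t e n → length (code t e (Θ↾ n)) ≡ position e n
length-code t e zero    = refl
length-code t e (suc n) = begin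
  length (code t e (Θ↾ (suc n)))                 ≡⟨ cong length (code-suc t e n) ⟩
  length (code t e (Θ↾ n) ++ block t (e (Θ n)))  ≡⟨ length-++ (code t e (Θ↾ n)) ⟩
  length (code t e (Θ↾ n)) + length (block t (e (Θ n)))
    ≡⟨ cong₂ _+_ (length-code t e n) (length-block t (e (Θ n))) ⟩
  position e (suc n)                             ∎
  where open ≡-Reasoning

At-code : ∀ t e {i n} → i < n → At (code t e (Θ↾ n)) (position e (suc i)) t
At-code t e {i} {suc n} i<1+n =
  subst (λ z → At z (position e (suc i)) t) (sym (code-suc t e n)) at
  where
  word = code t e (Θ↾ n) ++ block t (e (Θ n))
  at : At word (position e (suc i)) t
  at with m<1+n⇒m<n∨m≡n i<1+n
  ... | inj₁ i<n  = At-++ˡ _ (At-code t e i<n)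
  ... | inj₂ refl = subst (λ k → At word (k + suc (e (Θ n))) t) (length-code t e n)
                      (At-++ʳ (code t e (Θ↾ n)) (At-block t (e (Θ n))))

At-code⁻ : ∀ t e n {k} → At (code t e (Θ↾ n)) k t → ∃ λ i → k ≡ position e i
At-code⁻ t e (suc n) {k} p
  with At-++⁻ (code t e (Θ↾ n)) (subst (λ z → At z k t) (code-suc t e n) p)
... | inj₁ q            = At-code⁻ t e n q
... | inj₂ (j , q , eq) =
  suc n , trans eq (cong₂ _+_ (length-code t e n) (At-block⁻ t (e (Θ n)) q))

position-mono-≤ : ∀ e {m n} → m ≤ n → position e m ≤ position e n
position-mono-≤ e {m} {n} m≤n with m≤n⇒m<n∨m≡n m≤n
... | inj₂ refl = ≤-refl
position-mono-≤ e {m} {suc n} _ | inj₁ (s≤s m≤n) =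
  ≤-trans (position-mono-≤ e m≤n) (m≤m+n _ _)

position-step-< : ∀ e n → position e n < position e (suc n)
position-step-< e n = m<m+n (position e n) (s≤s z≤n)

position-mono-< : ∀ e {m n} → m < n → position e m < position e n
position-mono-< e {m} m<n = <-≤-trans (position-step-< e m) (position-mono-≤ e m<n)

position-cancel-< : ∀ e {m n} → position e m < position e n → m < n
position-cancel-< e lt = ≰⇒> λ n≤m → <⇒≱ lt (position-mono-≤ e n≤m)

n≤position : ∀ e n → n ≤ position e n
n≤position e zero    = z≤n
n≤position e (suc n) = ≤-<-trans (n≤position e n) (position-step-< e n)

position-≤ : ∀ d e → (∀ l → d l ≤ e l) → ∀ n → position d n ≤ position e n
position-≤ d e d≤e zero    = z≤n
position-≤ d e d≤e (suc n) = +-mono-≤ (position-≤ d e d≤e n) (s≤s (d≤e (Θ n)))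

position-+ : ∀ d e f → (∀ l → suc (d l) + suc (e l) ≡ suc (f l)) →
             ∀ n → position d n + position e n ≡ position f n
position-+ d e f d+e≡f zero    = refl
position-+ d e f d+e≡f (suc n) =
  trans (interchange (position d n) (suc (d (Θ n))) (position e n) (suc (e (Θ n))))
        (cong₂ _+_ (position-+ d e f d+e≡f n) (d+e≡f (Θ n)))

-- Complementary sequences

-- The infinite words true-coding d and false-coding e of Θ coincide, stated
-- on prefixes: a padding of entries true may be needed to complete a block.
Coupled : (Letter → ℕ) → (Letter → ℕ) → Set
Coupled d e = ∀ n → ∃₂ λ n′ r → n ≤ n′ ×
  code true d (Θ↾ n′) ≡ code false e (Θ↾ n) ++ replicate r true

coupled⇒disjoint : ∀ d e → Coupled d e → ∀ i j → position d (suc i) ≢ position e j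
coupled⇒disjoint d e coupled i zero    eq =
  n≮0 (subst (position d i <_) eq (position-step-< d i))
-- A prefix of length 1 + i + j is long enough to contain both marks.
coupled⇒disjoint d e coupled i (suc j) eq
  with n′ , r , n≤n′ , words≡ ← coupled (suc (i + j))
  with () ← At-functional
    (subst (λ z → At z (position d (suc i)) true) words≡
      (At-code true d (<-≤-trans (s≤s (m≤m+n i j)) n≤n′)))
    (subst (λ k → At (code false e (Θ↾ (suc (i + j))) ++ replicate r true) k false) (sym eq)
      (At-++ˡ (replicate r true) (At-code false e (s≤s (m≤n+m j i)))))

coupled⇒cover : ∀ d e → Coupled d e → ∀ k →
                (∃ λ i → k ≡ position d i) ⊎ (∃ λ j → k ≡ position e j)
coupled⇒cover d e coupled zero      = inj₁ (0 , refl)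
coupled⇒cover d e coupled k@(suc _)
  with n′ , r , k≤n′ , words≡ ← coupled k
  with At-total (code true d (Θ↾ n′)) (s≤s z≤n)
         (≤-trans (≤-trans k≤n′ (n≤position d n′))
                  (≤-reflexive (sym (length-code true d n′))))
... | true  , p = inj₁ (At-code⁻ true d n′ p)
... | false , p
  with At-++⁻ (code false e (Θ↾ k)) (subst (λ z → At z k false) words≡ p)
... | inj₁ q            = inj₂ (At-code⁻ false e k q)
... | inj₂ (_ , q , _) with () ← At-replicate⁻ r q

-- Minimal excluded values

IsMex-unique : ∀ {S m n} → IsMex S m → IsMex S n → m ≡ n
IsMex-unique (m∉ , m≤) (n∉ , n≤) = ≤-antisym (m≤ _ n∉) (n≤ _ m∉)

-- The values of f and g at the arguments below n.
below : (ℕ → ℕ) → (ℕ → ℕ) → ℕ → List ℕ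
below f g zero    = []
below f g (suc n) = f n ∷ g n ∷ below f g n

∈-belowˡ : ∀ f g {i n} → i < n → f i ∈ below f g n
∈-belowˡ f g {i} {suc n} i<1+n with m<1+n⇒m<n∨m≡n i<1+n
... | inj₁ i<n  = there (there (∈-belowˡ f g i<n))
... | inj₂ refl = here refl

∈-belowʳ : ∀ f g {i n} → i < n → g i ∈ below f g n
∈-belowʳ f g {i} {suc n} i<1+n with m<1+n⇒m<n∨m≡n i<1+n
... | inj₁ i<n  = there (there (∈-belowʳ f g i<n))
... | inj₂ refl = there (here refl)

∈-below⁻ : ∀ f g n {k} → k ∈ below f g n → ∃ λ i → i < n × (k ≡ f i ⊎ k ≡ g i)
∈-below⁻ f g (suc n) (here eq)         = n , ≤-refl , inj₁ eq
∈-below⁻ f g (suc n) (there (here eq)) = n , ≤-refl , inj₂ eq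
∈-below⁻ f g (suc n) (there (there p)) with i , i<n , eq ← ∈-below⁻ f g n p =
  i , m<n⇒m<1+n i<n , eq

coupled⇒IsMex : ∀ d e → Coupled d e → (∀ l → d l ≤ e l) → ∀ n →
  IsMex (below (position d) (position e) (suc n)) (position d (suc n))
coupled⇒IsMex d e coupled d≤e n = excluded , least
  where
  S = below (position d) (position e) (suc n)

  excluded : position d (suc n) ∉ S
  excluded p with ∈-below⁻ (position d) (position e) (suc n) p
  ... | i , i<1+n , inj₁ eq = <⇒≢ (position-mono-< d i<1+n) (sym eq)
  ... | i , _     , inj₂ eq = coupled⇒disjoint d e coupled n i eq

  least : ∀ k → k ∉ S → position d (suc n) ≤ k
  least k k∉S = ≮⇒≥ λ k<pos → k∉S (k∈S k<pos)
    where
    k∈S : k < position d (suc n) → k ∈ S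
    k∈S k<pos with coupled⇒cover d e coupled k
    ... | inj₁ (i , refl) = ∈-belowˡ (position d) (position e) {i} (position-cancel-< d {i} k<pos)
    ... | inj₂ (j , refl) = ∈-belowʳ (position d) (position e) {j}
      (position-cancel-< d {j} (≤-<-trans (position-≤ d e d≤e j) k<pos))

coupled⇒mex : ∀ d e → Coupled d e → (∀ l → d l ≤ e l) → ∀ n →
  mex (below (position d) (position e) (suc n)) ≡ position d (suc n)
coupled⇒mex d e coupled d≤e n =
  IsMex-unique (mex-isMex _) (coupled⇒IsMex d e coupled d≤e n)

-- The four sequences

-- One less than the values substituted for the letters in the four claims.
dX dY dM dP : Letter → ℕ
dX a = 1
dX b = 0
dX c = 0
dY a = 2
dY b = 2
dY c = 1
dM a = 0
dM b = 1
dM c = 0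
dP a = 4
dP b = 3
dP c = 2

-- The sequences with the claimed differences.
private
  x y m p : ℕ → ℕ
  x = position dX
  y = position dY
  m = position dM
  p = position dP

X-Y-coupled : Coupled dX dY
X-Y-coupled n with n′ , n≤n′ , eq ← Θ-desubstitute n = n′ , 1 , n≤n′ , (begin
  φ (Θ↾ n′)                           ≡⟨ cong φ eq ⟩
  true ∷ φ (τ* (Θ↾ n))                ≡⟨ cong (true ∷_) (concatMap-concatMap _ τ (Θ↾ n)) ⟩
  true ∷ concatMap (φ ∘ τ) (Θ↾ n)
    ≡⟨ conjugate (block false ∘ dY) (φ ∘ τ) [ true ] letterwise (Θ↾ n) ⟨
  code false dY (Θ↾ n) ++ [ true ]    ∎)
  where
  open ≡-Reasoning
  φ = code true dX
  letterwise : ∀ l → block false (dY l) ++ [ true ] ≡ true ∷ φ (τ l)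
  letterwise a = refl
  letterwise b = refl
  letterwise c = refl

M-P-coupled : Coupled dM dP
M-P-coupled n
  with n′ , n≤n′ , eq ← Θ-desubstitute n
  with n″ , n′≤n″ , eq′ ← Θ-desubstitute n′ = n″ , 2 , ≤-trans n≤n′ n′≤n″ , (begin
  μ (Θ↾ n″)                                 ≡⟨ cong μ eq′ ⟩
  true ∷ μ (τ* (Θ↾ n′))                     ≡⟨ cong (λ u → true ∷ μ (τ* u)) eq ⟩
  true ∷ true ∷ μ (τ* (τ* (Θ↾ n)))
    ≡⟨ cong (λ u → true ∷ true ∷ μ u) (concatMap-concatMap τ τ (Θ↾ n)) ⟩
  true ∷ true ∷ μ (concatMap (τ* ∘ τ) (Θ↾ n))
    ≡⟨ cong (λ z → true ∷ true ∷ z) (concatMap-concatMap _ (τ* ∘ τ) (Θ↾ n)) ⟩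
  true ∷ true ∷ concatMap (μ ∘ τ* ∘ τ) (Θ↾ n)
    ≡⟨ conjugate (block false ∘ dP) (μ ∘ τ* ∘ τ) MM letterwise (Θ↾ n) ⟨
  code false dP (Θ↾ n) ++ MM                ∎)
  where
  open ≡-Reasoning
  μ  = code true dM
  MM = true ∷ true ∷ []
  letterwise : ∀ l → block false (dP l) ++ MM ≡ MM ++ μ (τ* (τ l))
  letterwise a = refl
  letterwise b = refl
  letterwise c = refl

dX≤dY : ∀ l → dX l ≤ dY l
dX≤dY a = s≤s z≤n
dX≤dY b = z≤n
dX≤dY c = z≤n

dM≤dP : ∀ l → dM l ≤ dP l
dM≤dP a = z≤n
dM≤dP b = s≤s z≤n
dM≤dP c = z≤n

x+m≡y : ∀ n → x n + m n ≡ y n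
x+m≡y = position-+ dX dM dY λ { a → refl ; b → refl ; c → refl }

x+y≡p : ∀ n → x n + y n ≡ p n
x+y≡p = position-+ dX dY dP λ { a → refl ; b → refl ; c → refl }

mutual
  X≡ : X ≗ x
  X≡ zero    = refl
  X≡ (suc n) = trans (cong mex (cong₂ _∷_ (X≡ n) (cong₂ _∷_ (Y≡ n) (XYs≡ n))))
                     (coupled⇒mex dX dY X-Y-coupled dX≤dY n)

  M≡ : M ≗ m
  M≡ zero    = refl
  M≡ (suc n) = trans (cong mex (cong₂ _∷_ (M≡ n) (cong₂ _∷_ (P≡ n) (MPs≡ n))))
                     (coupled⇒mex dM dP M-P-coupled dM≤dP n)

  Y≡ : Y ≗ y
  Y≡ zero    = refl
  Y≡ (suc n) = trans (cong₂ _+_ (X≡ (suc n)) (M≡ (suc n))) (x+m≡y (suc n))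

  P≡ : P ≗ p
  P≡ zero    = refl
  P≡ (suc n) = trans (cong₂ _+_ (X≡ (suc n)) (Y≡ (suc n))) (x+y≡p (suc n))

  XYs≡ : XYs ≗ below x y
  XYs≡ zero    = refl
  XYs≡ (suc n) = cong₂ _∷_ (X≡ n) (cong₂ _∷_ (Y≡ n) (XYs≡ n))

  MPs≡ : MPs ≗ below m p
  MPs≡ zero    = refl
  MPs≡ (suc n) = cong₂ _∷_ (M≡ n) (cong₂ _∷_ (P≡ n) (MPs≡ n))

Δ-position : ∀ e {s} → s ≗ position e → ∀ n → Δ s n ≡ + suc (e (Θ n))
Δ-position e {s} s≡ n = begin
  + s (suc n) ℤ.- + s n  ≡⟨ cong₂ (λ i j → + i ℤ.- + j) (s≡ (suc n)) (s≡ n) ⟩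
  + (k + d) ℤ.- + k      ≡⟨ m-n≡m⊖n (k + d) k ⟩
  (k + d) ℤ.⊖ k          ≡⟨ ⊖-≥ (m≤m+n k d) ⟩
  + (k + d ∸ k)          ≡⟨ cong +_ (m+n∸m≡n k d) ⟩
  + d                    ∎
  where
  open ≡-Reasoning
  k = position e n
  d = suc (e (Θ n))

+suc≡replaceBy : ∀ (e : Letter → ℕ) l → + suc (e l) ≡
  replaceBy (+ suc (e a)) (+ suc (e b)) (+ suc (e c)) l
+suc≡replaceBy e a = refl
+suc≡replaceBy e b = refl
+suc≡replaceBy e c = refl

theorem20 : (Δ X ≗ Θ⟨ + 2 , + 1 , + 1 ⟩) ×
    (Δ Y ≗ Θ⟨ + 3 , + 3 , + 2 ⟩) ×
    (Δ M ≗ Θ⟨ + 1 , + 2 , + 1 ⟩) ×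
    (Δ P ≗ Θ⟨ + 5 , + 4 , + 3 ⟩)
theorem20 =
  (λ n → trans (Δ-position dX X≡ n) (+suc≡replaceBy dX (Θ n))) ,
  (λ n → trans (Δ-position dY Y≡ n) (+suc≡replaceBy dY (Θ n))) ,
  (λ n → trans (Δ-position dM M≡ n) (+suc≡replaceBy dM (Θ n))) ,
  (λ n → trans (Δ-position dP P≡ n) (+suc≡replaceBy dP (Θ n)))
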